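{- (1) Let $(S,K,I)$ be an active split graph. Then $S$ is prime if and only if $\Phi(S)$ is connected. (2) Let $(S_1,K_1,I_1),\dots,(S_n,K_n,I_n)$ be pairwise vertex-disjoint prime split graphs and let $S=S_1\circ S_2\circ\cdots\circ S_n$, regarded as a split graph with bipartition $(K_1\cup\dots\cup K_n,\ I_1\cup\dots\cup I_n)$. Then $\Phi(S)=\Phi(S_1)\,\dot\cup\,\cdots\,\dot\cup\,\Phi(S_n)$ (disjoint union of multigraphs). (3) If $G$ is an active graph and $G=G_n\circ\cdots\circ G_1$ is its Tyshkevich decomposition into indecomposable factors each having at least one vertex (with $G_2,\dots,G_n$ split), then every factor $G_r$ is prime.
   Context: All graphs are finite and simple. A split graph is a graph $S$ whose vertex set is a disjoint union $V(S)=K\,\dot\cup\,I$ with $K$ a clique and $I$ an independent set; $(K,I)$ is called a bipartition of $S$, and $(S,K,I)$ denotes $S$ together with this fixed bipartition. A 2-switch in a graph $G$ is performed on four distinct vertices $a,b,c,d$ with $ab,cd\in E(G)$ and $ac,bd\notin E(G)$: it deletes $ab,cd$ and adds $ac,bd$; $a,b,c,d$ are said to participate in it. A vertex is active in $G$ if it participates in some 2-switch on $G$, otherwise inactive; $G$ is active if all its vertices are active. For a split graph $(S,K,I)$ and distinct $u,v\in I$, $\sigma_{uv}(S)$ is the number of induced subgraphs of $S$ isomorphic to $P_4$ containing both $u$ and $v$. The factor graph $\Phi(S)$ is the loopless multigraph with vertex set $I$ having exactly $\sigma_{uv}(S)$ parallel edges between $u$ and $v$. Graph notions (connected, complete, clique,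 etc.) applied to $\Phi(S)$ refer to its underlying simple graph, in which $u\sim v$ iff $\sigma_{uv}(S)\ge1$. Tyshkevich composition: for a split graph $(S,K,I)$ and a graph $G$ vertex-disjoint from $S$, $S\circ G$ is the graph with vertex set $V(S)\cup V(G)$ and edge set $E(S)\cup E(G)\cup\{xy: x\in K,\ y\in V(G)\}$ (a composition of a split graph with a split graph is split, with clique the union of the cliques and independent set the union of the independent sets). A graph $G$ is decomposable if $G=S\circ H$ for some split graph $S$ and graph $H$, each with at least one vertex; otherwise indecomposable. A graph is prime if it is active and indecomposable. Tyshkevich's theorem (known): every graph $G$ can be written as $G=G_n\circ\cdots\circ G_1$ with each $G_r$ indecomposable and $G_2,\dots,G_n$ split; with all $|G_r|\ge1$ this decomposition is unique up to isomorphism. -}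

module Defs where

open import Data.Bool using (if_then_else_)
open import Data.Empty using (⊥-elim)
open import Data.Fin using (Fin; zero; suc; toℕ)
open import Data.Fin.Properties using (all?; any?) renaming (_≟_ to _≟ᶠ_)
open import Data.Fin.Subset using (Subset; inside; outside; _∈_; _∉_; _⊆_; _∩_; _∪_; ⊤; Nonempty)
  renaming (⊥ to ∅)
open import Data.Fin.Subset.Properties
  using (_∈?_; _⊆?_; ∈⊤; ∉⊥; x∈p∩q⁺; x∈p∩q⁻; x∈p∪q⁺; x∈p∪q⁻; p⊆p∪q; q⊆p∪q; ⊆-antisym)
open import Data.List using (List; []; _∷_; _∷ʳ_; _++_; length; filter; map; foldr)
open import Data.List.Membership.Propositional using () renaming (_∈_ to _∈ˡ_)
open import Data.List.Properties using (filter-≐)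
open import Data.List.Relation.Unary.All using (All; []; _∷_)
open import Data.List.Relation.Unary.AllPairs using (AllPairs; []; _∷_)
open import Data.List.Relation.Unary.Unique.Propositional using (Unique)
open import Data.Nat using (ℕ; zero; suc; _+_; _≤_; _≤?_; z≤n; s≤s; _≟_)
open import Data.Product using (Σ; ∃; ∃-syntax; _×_; _,_; proj₁; proj₂)
open import Data.Sum using (_⊎_; inj₁; inj₂; [_,_]′; swap)
open import Data.Vec using (Vec; []; _∷_; lookup)
open import Data.Vec.Properties.WithK using ([]=-irrelevant)
open import Function using (_↔_; mk↔ₛ′; _⇔_; mk⇔; Inverse; Equivalence)
open import Level using (0ℓ)
open import Relation.Binary.Construct.Closure.ReflexiveTransitive using (Star)
open import Relation.Binary.Core using (Rel)
open import Relation.Binary.Definitions using (Decidable; Symmetric)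
open import Relation.Binary.PropositionalEquality
  using (_≡_; _≢_; refl; sym; trans; cong; cong₂; subst; subst₂)
open import Relation.Nullary using (¬_; Dec; yes; no; does)
open import Relation.Nullary.Decidable using (map′; _×-dec_; _⊎-dec_; _→-dec_; ¬?)

------------------------------------------------------------------------
-- Graphs

-- All the graphs occurring together have their vertices in one ambient
-- finite set Fin N, with N arbitrary, and the vertex set of each of them is
-- a subset V of it.  So "vertex-disjoint", "V(S) ∪ V(G)" and "G = S ∘ H"
-- are meant literally and not up to isomorphism.

record Graph (N : ℕ) : Set₁ where
  field
    V       : Subset N
    E       : Rel (Fin N) 0ℓ
    E?      : Decidable E
    E-sym   : Symmetric E
    E-irr   : ∀ {u} → ¬ E u u
    E⇒∈V    : ∀ {u v} → E u v → u ∈ V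

open Graph public

infix 4 _≈_ _≅_

record _≈_ {N} (G H : Graph N) : Set where
  field
    V-≡ : V G ≡ V H
    E-⇔ : ∀ u v → E G u v ⇔ E H u v

Vertex : ∀ {N} → Graph N → Set
Vertex G = ∃[ v ] v ∈ V G

record _≅_ {M N} (G : Graph M) (H : Graph N) : Set where
  field
    bijection : Vertex G ↔ Vertex H
  to = Inverse.to bijection
  field
    edges : ∀ u v → E G (proj₁ u) (proj₁ v) ⇔ E H (proj₁ (to u)) (proj₁ (to v))

infix 8 _[_]

_[_] : ∀ {N} → Graph N → Subset N → Graph N
G [ X ] = record
  { V     = V G ∩ X
  ; E     = λ u v → E G u v × u ∈ X × v ∈ X
  ; E?    = λ u v → E? G u v ×-dec (u ∈? X) ×-dec (v ∈? X)
  ; E-sym = λ (e , p , q) → E-sym G e , q , p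
  ; E-irr = λ (e , _) → E-irr G e
  ; E⇒∈V  = λ (e , p , _) → x∈p∩q⁺ (E⇒∈V G e , p)
  }

Connected : ∀ {N} → Graph N → Set
Connected G = ∀ {u v} → u ∈ V G → v ∈ V G → Star (E G) u v

Disjoint : ∀ {N} → Graph N → Graph N → Set
Disjoint G H = ∀ {v} → v ∈ V G → v ∉ V H

------------------------------------------------------------------------
-- 2-switches and active graphs

record TwoSwitch {N} (G : Graph N) (a b c d : Fin N) : Set where
  field
    distinct : Unique (a ∷ b ∷ c ∷ d ∷ [])
    ab∈E     : E G a b
    cd∈E     : E G c d
    ac∉E     : ¬ E G a c
    bd∉E     : ¬ E G b d

ActiveVertex : ∀ {N} → Graph N → Fin N → Set
ActiveVertex G v = ∃[ a ] ∃[ b ] ∃[ c ] ∃[ d ]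
  TwoSwitch G a b c d × v ∈ˡ (a ∷ b ∷ c ∷ d ∷ [])

Active : ∀ {N} → Graph N → Set
Active G = ∀ {v} → v ∈ V G → ActiveVertex G v

------------------------------------------------------------------------
-- Split graphs with a fixed bipartition

record SplitGraph (N : ℕ) : Set₁ where
  field
    graph       : Graph N
    K I         : Subset N
    V≡K∪I       : V graph ≡ K ∪ I
    K-I         : ∀ {v} → v ∈ K → v ∉ I
    clique      : ∀ {u v} → u ∈ K → v ∈ K → u ≢ v → E graph u v
    independent : ∀ {u v} → u ∈ I → v ∈ I → ¬ E graph u v

  K⇒V : ∀ {v} → v ∈ K → v ∈ V graph
  K⇒V p = subst (_ ∈_) (sym V≡K∪I) (p⊆p∪q I p)

  I⇒V : ∀ {v} → v ∈ I → v ∈ V graph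
  I⇒V p = subst (_ ∈_) (sym V≡K∪I) (q⊆p∪q K I p)

open SplitGraph public

------------------------------------------------------------------------
-- Tyshkevich composition

compose : ∀ {N} (S : SplitGraph N) (G : Graph N) → Disjoint (graph S) G → Graph N
compose {N} S G disj = record
  { V     = V (graph S) ∪ V G
  ; E     = E′
  ; E?    = λ u v → E? (graph S) u v ⊎-dec E? G u v
                ⊎-dec ((u ∈? K S) ×-dec (v ∈? V G))
                ⊎-dec ((v ∈? K S) ×-dec (u ∈? V G))
  ; E-sym = λ { (inj₁ e)        → inj₁ (E-sym (graph S) e)
              ; (inj₂ (inj₁ e)) → inj₂ (inj₁ (E-sym G e))
              ; (inj₂ (inj₂ e)) → inj₂ (inj₂ (swap e)) }
  ; E-irr = λ { (inj₁ e)                      → E-irr (graph S) e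
              ; (inj₂ (inj₁ e))               → E-irr G e
              ; (inj₂ (inj₂ (inj₁ (p , q)))) → disj (K⇒V S p) q
              ; (inj₂ (inj₂ (inj₂ (p , q)))) → disj (K⇒V S p) q }
  ; E⇒∈V  = λ { (inj₁ e)                      → x∈p∪q⁺ (inj₁ (E⇒∈V (graph S) e))
              ; (inj₂ (inj₁ e))               → x∈p∪q⁺ (inj₂ (E⇒∈V G e))
              ; (inj₂ (inj₂ (inj₁ (p , _)))) → x∈p∪q⁺ (inj₁ (K⇒V S p))
              ; (inj₂ (inj₂ (inj₂ (_ , q)))) → x∈p∪q⁺ (inj₂ q) }
  }
  where
  E′ : Rel (Fin N) 0ℓ
  E′ u v = E (graph S) u v ⊎ E G u v ⊎ (u ∈ K S × v ∈ V G) ⊎ (v ∈ K S × u ∈ V G)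

private
  ∪-swap : ∀ {N} {v : Fin N} (A B C D : Subset N) →
           v ∈ (A ∪ B) ∪ (C ∪ D) → v ∈ (A ∪ C) ∪ (B ∪ D)
  ∪-swap A B C D p with x∈p∪q⁻ (A ∪ B) (C ∪ D) p
  ... | inj₁ q = [ (λ r → x∈p∪q⁺ (inj₁ (x∈p∪q⁺ (inj₁ r))))
                 , (λ r → x∈p∪q⁺ (inj₂ (x∈p∪q⁺ (inj₁ r)))) ]′ (x∈p∪q⁻ A B q)
  ... | inj₂ q = [ (λ r → x∈p∪q⁺ (inj₁ (x∈p∪q⁺ (inj₂ r))))
                 , (λ r → x∈p∪q⁺ (inj₂ (x∈p∪q⁺ (inj₂ r)))) ]′ (x∈p∪q⁻ C D q)

composeSplit : ∀ {N} (S T : SplitGraph N) → Disjoint (graph S) (graph T) → SplitGraph N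
composeSplit S T disj = record
  { graph       = compose S (graph T) disj
  ; K           = K S ∪ K T
  ; I           = I S ∪ I T
  ; V≡K∪I       = trans (cong₂ _∪_ (V≡K∪I S) (V≡K∪I T))
                    (⊆-antisym (∪-swap (K S) (I S) (K T) (I T))
                               (∪-swap (K S) (K T) (I S) (I T)))
  ; K-I         = K-I′
  ; clique      = clique′
  ; independent = independent′
  }
  where
  K-I′ : ∀ {v} → v ∈ K S ∪ K T → v ∉ I S ∪ I T
  K-I′ p q with x∈p∪q⁻ (K S) (K T) p | x∈p∪q⁻ (I S) (I T) q
  ... | inj₁ k | inj₁ i = K-I S k i
  ... | inj₁ k | inj₂ i = disj (K⇒V S k) (I⇒V T i)
  ... | inj₂ k | inj₁ i = disj (I⇒V S i) (K⇒V T k)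
  ... | inj₂ k | inj₂ i = K-I T k i

  clique′ : ∀ {u v} → u ∈ K S ∪ K T → v ∈ K S ∪ K T → u ≢ v →
            E (compose S (graph T) disj) u v
  clique′ p q u≢v with x∈p∪q⁻ (K S) (K T) p | x∈p∪q⁻ (K S) (K T) q
  ... | inj₁ k | inj₁ l = inj₁ (clique S k l u≢v)
  ... | inj₁ k | inj₂ l = inj₂ (inj₂ (inj₁ (k , K⇒V T l)))
  ... | inj₂ k | inj₁ l = inj₂ (inj₂ (inj₂ (l , K⇒V T k)))
  ... | inj₂ k | inj₂ l = inj₂ (inj₁ (clique T k l u≢v))

  notI : ∀ {v} → v ∈ K S → v ∉ I S ∪ I T
  notI k = K-I′ (x∈p∪q⁺ (inj₁ k))

  independent′ : ∀ {u v} → u ∈ I S ∪ I T → v ∈ I S ∪ I T →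
                 ¬ E (compose S (graph T) disj) u v
  independent′ p q (inj₂ (inj₂ (inj₁ (k , _)))) = notI k p
  independent′ p q (inj₂ (inj₂ (inj₂ (k , _)))) = notI k q
  independent′ p q (inj₁ e) with x∈p∪q⁻ (I S) (I T) p | x∈p∪q⁻ (I S) (I T) q
  ... | inj₁ i | inj₁ j = independent S i j e
  ... | inj₂ i | _      = disj (E⇒∈V (graph S) e) (I⇒V T i)
  ... | inj₁ _ | inj₂ j = disj (E⇒∈V (graph S) (E-sym (graph S) e)) (I⇒V T j)
  independent′ p q (inj₂ (inj₁ e)) with x∈p∪q⁻ (I S) (I T) p | x∈p∪q⁻ (I S) (I T) q
  ... | inj₂ i | inj₂ j = independent T i j e
  ... | inj₁ i | _      = disj (I⇒V S i) (E⇒∈V (graph T) e)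
  ... | inj₂ _ | inj₁ j = disj (I⇒V S j) (E⇒∈V (graph T) (E-sym (graph T) e))

-- The factors, in order, of S ∘ … ∘ S′ ∘ G: all but the last are split.
factors : ∀ {N} → List (SplitGraph N) → Graph N → List (Graph N)
factors Ss G = map graph Ss ∷ʳ G

mutual
  -- composeAll (S ∷ … ∷ S′ ∷ []) G  =  S ∘ (… ∘ (S′ ∘ G))
  composeAll : ∀ {N} (Ss : List (SplitGraph N)) (G : Graph N) →
               AllPairs Disjoint (factors Ss G) → Graph N
  composeAll []       G _        = G
  composeAll (S ∷ Ss) G (d ∷ ds) =
    compose S (composeAll Ss G ds) (disjoint-composeAll (graph S) Ss G ds d)

  disjoint-composeAll : ∀ {N} (H : Graph N) (Ss : List (SplitGraph N)) (G : Graph N)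
                        (ds : AllPairs Disjoint (factors Ss G)) →
                        All (Disjoint H) (factors Ss G) → Disjoint H (composeAll Ss G ds)
  disjoint-composeAll H []       G _        (p ∷ _)  = p
  disjoint-composeAll H (S ∷ Ss) G (d ∷ ds) (p ∷ ps) v∈H v∈C
    with x∈p∪q⁻ (V (graph S)) (V (composeAll Ss G ds)) v∈C
  ... | inj₁ q = p v∈H q
  ... | inj₂ q = disjoint-composeAll H Ss G ds ps v∈H q

mutual
  -- composeAllSplit S₁ (S₂ ∷ … ∷ Sₙ ∷ [])  =  S₁ ∘ (S₂ ∘ (… ∘ Sₙ)),
  -- with bipartition (K₁ ∪ (K₂ ∪ …) , I₁ ∪ (I₂ ∪ …))
  composeAllSplit : ∀ {N} (S : SplitGraph N) (Ss : List (SplitGraph N)) →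
                    AllPairs Disjoint (map graph (S ∷ Ss)) → SplitGraph N
  composeAllSplit S []       _        = S
  composeAllSplit S (T ∷ Ts) (d ∷ ds) =
    composeSplit S (composeAllSplit T Ts ds) (disjoint-composeAllSplit (graph S) T Ts ds d)

  disjoint-composeAllSplit : ∀ {N} (H : Graph N) (S : SplitGraph N) (Ss : List (SplitGraph N))
                             (ds : AllPairs Disjoint (map graph (S ∷ Ss))) →
                             All (Disjoint H) (map graph (S ∷ Ss)) →
                             Disjoint H (graph (composeAllSplit S Ss ds))
  disjoint-composeAllSplit H S []       _        (p ∷ _)  = p
  disjoint-composeAllSplit H S (T ∷ Ts) (d ∷ ds) (p ∷ ps) v∈H v∈C
    with x∈p∪q⁻ (V (graph S)) (V (graph (composeAllSplit T Ts ds))) v∈C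
  ... | inj₁ q = p v∈H q
  ... | inj₂ q = disjoint-composeAllSplit H T Ts ds ps v∈H q

Decomposable : ∀ {N} → Graph N → Set₁
Decomposable {N} G = Σ (SplitGraph N) λ S → Σ (Graph N) λ H → Σ (Disjoint (graph S) H) λ disj →
  Nonempty (V (graph S)) × Nonempty (V H) × G ≈ compose S H disj

Indecomposable : ∀ {N} → Graph N → Set₁
Indecomposable G = ¬ Decomposable G

Prime : ∀ {N} → Graph N → Set₁
Prime G = Active G × Indecomposable G

------------------------------------------------------------------------
-- Induced P₄'s

P₄ : Graph 4
P₄ = record
  { V     = ⊤
  ; E     = λ i j → suc (toℕ i) ≡ toℕ j ⊎ suc (toℕ j) ≡ toℕ i
  ; E?    = λ i j → (suc (toℕ i) ≟ toℕ j) ⊎-dec (suc (toℕ j) ≟ toℕ i)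
  ; E-sym = swap
  ; E-irr = [ 1+n≢n , 1+n≢n ]′
  ; E⇒∈V  = λ _ → ∈⊤
  }
  where open import Data.Nat.Properties using (1+n≢n)

Vertex-≡ : ∀ {N} {G : Graph N} {u v : Vertex G} → proj₁ u ≡ proj₁ v → u ≡ v
Vertex-≡ {u = u , p} {v = .u , q} refl = cong (u ,_) ([]=-irrelevant p q)

_⇔-dec_ : ∀ {A B : Set} → Dec A → Dec B → Dec (A ⇔ B)
a? ⇔-dec b? = map′ (λ (f , g) → mk⇔ f g) (λ e → Equivalence.to e , Equivalence.from e)
                   ((a? →-dec b?) ×-dec (b? →-dec a?))

module _ {N} (G : Graph N) where

  Labelling : (Fin 4 → Fin N) → Set
  Labelling f = (∀ i → f i ∈ V G)
              × (∀ v → v ∈ V G → ∃[ i ] f i ≡ v)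
              × (∀ i j → f i ≡ f j → i ≡ j)
              × (∀ i j → E G (f i) (f j) ⇔ E P₄ i j)

  labelling? : ∀ f → Dec (Labelling f)
  labelling? f =
    all? (λ i → f i ∈? V G)
    ×-dec all? (λ v → (v ∈? V G) →-dec any? (λ i → f i ≟ᶠ v))
    ×-dec all? (λ i → all? λ j → (f i ≟ᶠ f j) →-dec (i ≟ᶠ j))
    ×-dec all? (λ i → all? λ j → E? G (f i) (f j) ⇔-dec E? P₄ i j)

  fromLabelling : ∀ {f} → Labelling f → G ≅ P₄
  fromLabelling {f} (mem , sur , inj , edg) = record
    { bijection = mk↔ₛ′
        (λ (v , p) → proj₁ (sur v p) , ∈⊤)
        (λ (i , _) → f i , mem i)
        (λ (i , _) → Vertex-≡ {G = P₄} (inj _ _ (proj₂ (sur (f i) (mem i)))))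
        (λ (v , p) → Vertex-≡ {G = G} (proj₂ (sur v p)))
    ; edges = λ (u , p) (v , q) →
        subst₂ (λ x y → E G x y ⇔ E P₄ (proj₁ (sur u p)) (proj₁ (sur v q)))
               (proj₂ (sur u p)) (proj₂ (sur v q)) (edg _ _)
    }

  quad : Fin N → Fin N → Fin N → Fin N → Fin 4 → Fin N
  quad a b c d = lookup (a ∷ b ∷ c ∷ d ∷ [])

  toLabelling : G ≅ P₄ → ∃[ a ] ∃[ b ] ∃[ c ] ∃[ d ] Labelling (quad a b c d)
  toLabelling iso = f 0F , f 1F , f 2F , f 3F , mem , sur , inj , edg
    where
    open import Data.Fin.Patterns using (0F; 1F; 2F; 3F)
    open Inverse (_≅_.bijection iso)

    f : Fin 4 → Fin N
    f i = proj₁ (from (i , ∈⊤))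

    g : Fin 4 → Fin N
    g = quad (f 0F) (f 1F) (f 2F) (f 3F)

    g≡f : ∀ i → g i ≡ f i
    g≡f 0F = refl
    g≡f 1F = refl
    g≡f 2F = refl
    g≡f 3F = refl

    to-f : ∀ i (p : f i ∈ V G) → proj₁ (to (f i , p)) ≡ i
    to-f i p = cong proj₁ (trans (cong to (Vertex-≡ {G = G} refl)) (strictlyInverseˡ (i , ∈⊤)))

    f∈V : ∀ i → f i ∈ V G
    f∈V i = proj₂ (from (i , ∈⊤))

    mem : ∀ i → g i ∈ V G
    mem i = subst (_∈ V G) (sym (g≡f i)) (f∈V i)

    sur : ∀ v → v ∈ V G → ∃[ i ] g i ≡ v
    sur v p = i , trans (g≡f i) (cong proj₁
                (trans (cong from (Vertex-≡ {G = P₄} refl)) (strictlyInverseʳ (v , p))))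
      where i = proj₁ (to (v , p))

    inj : ∀ i j → g i ≡ g j → i ≡ j
    inj i j eq = trans (sym (to-f i (f∈V i)))
      (trans (cong (λ x → proj₁ (to x))
               (Vertex-≡ {G = G} (trans (sym (g≡f i)) (trans eq (g≡f j)))))
             (to-f j (f∈V j)))

    edg : ∀ i j → E G (g i) (g j) ⇔ E P₄ i j
    edg i j rewrite g≡f i | g≡f j =
      subst₂ (λ x y → E G (f i) (f j) ⇔ E P₄ x y) (to-f i (f∈V i)) (to-f j (f∈V j))
             (_≅_.edges iso (f i , f∈V i) (f j , f∈V j))

-- Opaque because unfolding it makes normal forms of σ unmanageable.
opaque
  ≅P₄? : ∀ {N} (G : Graph N) → Dec (G ≅ P₄)
  ≅P₄? G = map′ (λ (_ , _ , _ , _ , l) → fromLabelling G l) (toLabelling G)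
    (any? λ a → any? λ b → any? λ c → any? λ d → labelling? G (quad G a b c d))

InducesP₄ : ∀ {N} → Graph N → Subset N → Set
InducesP₄ G X = X ⊆ V G × G [ X ] ≅ P₄

subsets : ∀ N → List (Subset N)
subsets zero    = [] ∷ []
subsets (suc N) = map (outside ∷_) (subsets N) ++ map (inside ∷_) (subsets N)

InducedP₄Through : ∀ {N} → Graph N → Fin N → Fin N → Subset N → Set
InducedP₄Through G u v X = InducesP₄ G X × u ∈ X × v ∈ X

inducedP₄Through? : ∀ {N} (G : Graph N) u v X → Dec (InducedP₄Through G u v X)
inducedP₄Through? G u v X = ((X ⊆? V G) ×-dec ≅P₄? (G [ X ])) ×-dec (u ∈? X) ×-dec (v ∈? X)

σ : ∀ {N} → SplitGraph N → Fin N → Fin N → ℕ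
σ {N} S u v = length (filter (inducedP₄Through? (graph S) u v) (subsets N))

------------------------------------------------------------------------
-- Multigraphs and the factor graph

record Multigraph (N : ℕ) : Set where
  field
    W         : Subset N
    mult      : Fin N → Fin N → ℕ
    mult-sym  : ∀ u v → mult u v ≡ mult v u
    mult-loop : ∀ u → mult u u ≡ 0
    mult⇒∈W   : ∀ {u v} → 1 ≤ mult u v → u ∈ W

open Multigraph public

infix 4 _≈ₘ_
infixr 6 _⊍_

record _≈ₘ_ {N} (M M′ : Multigraph N) : Set where
  field
    W-≡    : W M ≡ W M′
    mult-≡ : ∀ u v → mult M u v ≡ mult M′ u v

∅ₘ : ∀ {N} → Multigraph N
∅ₘ = record
  { W = ∅ ; mult = λ _ _ → 0 ; mult-sym = λ _ _ → refl ; mult-loop = λ _ → refl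
  ; mult⇒∈W = λ () }

-- Since mult vanishes off the vertex set, the sum below is the disjoint
-- union as soon as the two vertex sets are disjoint.
_⊍_ : ∀ {N} → Multigraph N → Multigraph N → Multigraph N
M ⊍ M′ = record
  { W         = W M ∪ W M′
  ; mult      = λ u v → mult M u v + mult M′ u v
  ; mult-sym  = λ u v → cong₂ _+_ (mult-sym M u v) (mult-sym M′ u v)
  ; mult-loop = λ u → cong₂ _+_ (mult-loop M u) (mult-loop M′ u)
  ; mult⇒∈W   = λ p → x∈p∪q⁺ ([ (λ q → inj₁ (mult⇒∈W M q)) , (λ q → inj₂ (mult⇒∈W M′ q)) ]′
                                (split _ p))
  }
  where
  split : ∀ m {n} → 1 ≤ m + n → 1 ≤ m ⊎ 1 ≤ n
  split zero    p = inj₂ p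
  split (suc m) _ = inj₁ (s≤s z≤n)

⨃ : ∀ {N} → List (Multigraph N) → Multigraph N
⨃ = foldr _⊍_ ∅ₘ

underlying : ∀ {N} → Multigraph N → Graph N
underlying M = record
  { V     = W M
  ; E     = λ u v → 1 ≤ mult M u v
  ; E?    = λ u v → 1 ≤? mult M u v
  ; E-sym = λ {u} {v} → subst (1 ≤_) (mult-sym M u v)
  ; E-irr = λ {u} p → 1≰0 (subst (1 ≤_) (mult-loop M u) p)
  ; E⇒∈V  = mult⇒∈W M
  }
  where
  1≰0 : ¬ 1 ≤ 0
  1≰0 ()

DistinctIn : ∀ {N} → Subset N → Fin N → Fin N → Set
DistinctIn X u v = u ∈ X × v ∈ X × u ≢ v

distinctIn? : ∀ {N} (X : Subset N) u v → Dec (DistinctIn X u v)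
distinctIn? X u v = (u ∈? X) ×-dec (v ∈? X) ×-dec ¬? (u ≟ᶠ v)

private
  if-cong : ∀ {A B : Set} (a? : Dec A) (b? : Dec B) {m n : ℕ} → (A → B) → (B → A) → m ≡ n →
            (if does a? then m else 0) ≡ (if does b? then n else 0)
  if-cong (yes _) (yes _) _ _ m≡n = m≡n
  if-cong (yes a) (no ¬b) f _ _   = ⊥-elim (¬b (f a))
  if-cong (no ¬a) (yes b) _ g _   = ⊥-elim (¬a (g b))
  if-cong (no _)  (no _)  _ _ _   = refl

  if-no : ∀ {A : Set} (a? : Dec A) {n : ℕ} → ¬ A → (if does a? then n else 0) ≡ 0
  if-no (yes a) ¬a = ⊥-elim (¬a a)
  if-no (no _)  _  = refl

  if-pos : ∀ {A : Set} (a? : Dec A) {n : ℕ} → 1 ≤ (if does a? then n else 0) → A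
  if-pos (yes a) _ = a
  if-pos (no _)  ()

  σ-sym : ∀ {N} (S : SplitGraph N) u v → σ S u v ≡ σ S v u
  σ-sym {N} S u v = cong length
    (filter-≐ (inducedP₄Through? (graph S) u v) (inducedP₄Through? (graph S) v u)
       ((λ (i , p , q) → i , q , p) , (λ (i , p , q) → i , q , p)) (subsets N))

Φ : ∀ {N} → SplitGraph N → Multigraph N
Φ {N} S = record
  { W         = I S
  ; mult      = m
  ; mult-sym  = m-sym
  ; mult-loop = m-loop
  ; mult⇒∈W   = m⇒∈
  }
  where
  m : Fin N → Fin N → ℕ
  m u v = if does (distinctIn? (I S) u v) then σ S u v else 0

  m-sym : ∀ u v → m u v ≡ m v u
  m-sym u v = if-cong (distinctIn? (I S) u v) (distinctIn? (I S) v u) flip flip (σ-sym S u v)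
    where
    flip : ∀ {x y} → DistinctIn (I S) x y → DistinctIn (I S) y x
    flip (p , q , x≢y) = q , p , λ y≡x → x≢y (sym y≡x)

  m-loop : ∀ u → m u u ≡ 0
  m-loop u = if-no (distinctIn? (I S) u u) λ (_ , _ , u≢u) → u≢u refl

  m⇒∈ : ∀ {u v} → 1 ≤ m u v → u ∈ I S
  m⇒∈ {u} {v} p = proj₁ (if-pos (distinctIn? (I S) u v) p)

{-# OPTIONS --safe #-}

-- Everything rests on one fact: in S ∘ H a 2-switch, hence an induced P₄, lies
-- wholly in S or wholly in H.  So activity passes to the factors, Φ(S ∘ T) is the
-- disjoint union of Φ(S) and Φ(T), and a path of Φ(S) cannot cross a decomposition
-- of an active S.  Conversely u and v are adjacent in Φ(S) when N(u) and N(v) are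
-- incomparable; if this relation is disconnected, I has an initial segment A for
-- inclusion of neighbourhoods, and A together with N(A) splits off as a factor.

module Submission where

open import Defs
open import Data.Bool using (if_then_else_)
open import Data.Empty using (⊥-elim)
open import Data.Fin using (Fin)
open import Data.Fin.Patterns using (0F; 1F; 2F; 3F)
open import Data.Fin.Properties using (all?; any?; ¬∀⟶∃¬) renaming (_≟_ to _≟ᶠ_)
open import Data.Fin.Subset using (Subset; inside; outside; _∈_; _∉_; _⊆_; _∪_; ∁; ⁅_⁆; ⊤; Nonempty)
open import Data.Fin.Subset.Induction using (Acc; acc; ⊃-wellFounded)
open import Data.Fin.Subset.Properties
  using (_∈?_; ∈⊤; x∈⁅x⁆; x∈⁅y⁆⇒x≡y; x∈∁p⇒x∉p; x∉p⇒x∈∁p; p⊆p∪q; q⊆p∪q; x∈p∪q⁺; x∈p∪q⁻;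
         x∈p∩q⁺; x∈p∩q⁻; ⊆-antisym; ∪-identityʳ)
open import Data.List using (List; []; _∷_; map; length)
open import Data.List.Membership.Propositional using () renaming (_∈_ to _∈ˡ_)
open import Data.List.Membership.Propositional.Properties
  using (∈-++⁺ˡ; ∈-++⁺ʳ; ∈-map⁺; ∈-filter⁺; ∈-filter⁻; ∈-length)
open import Data.List.Properties using (filter-≐; filter-none)
open import Data.List.Relation.Unary.All as All using (All; []; _∷_)
open import Data.List.Relation.Unary.AllPairs using (AllPairs; []; _∷_)
open import Data.List.Relation.Unary.Any using (here; there)
open import Data.Nat using (ℕ; _+_; _≤_)
open import Data.Nat.Properties using (+-identityʳ)
open import Data.Product using (∃-syntax; _×_; _,_; proj₁; proj₂)
open import Data.Sum using (_⊎_; inj₁; inj₂; [_,_]′)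
open import Data.Vec using ([]; _∷_; tabulate)
open import Data.Vec.Properties using (lookup∘tabulate; lookup⇒[]=; []=⇒lookup)
import Data.Vec.Relation.Unary.All as VecAll
import Data.Vec.Relation.Unary.AllPairs as VecAllPairs
open import Data.Vec.Relation.Unary.Unique.Propositional.Properties using (lookup-injective)
open import Function.Construct.Symmetry using (⇔-sym)
open import Function using (_∘_; _⇔_; mk⇔; Equivalence)
open import Level using (0ℓ)
open import Relation.Binary.Construct.Closure.ReflexiveTransitive as Star using (Star; ε; _◅_; _◅◅_)
open import Relation.Binary.Core using (Rel)
open import Relation.Binary.Definitions using (Decidable)
open import Relation.Binary.PropositionalEquality
  using (_≡_; _≢_; refl; sym; trans; cong; cong₂; subst; ≢-sym)
open import Relation.Nullary using (¬_; Dec; yes; no; does)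
open import Relation.Nullary.Decidable
  using (_×-dec_; _⊎-dec_; _→-dec_; ¬?; decidable-stable; dec-true; from-yes; from-no)
import Relation.Unary as U

open Equivalence using (to; from)

-- Decidable subsets, counting and reachability.

module _ {n} {P : Fin n → Set} (P? : U.Decidable P) where

  subsetOf : Subset n
  subsetOf = tabulate (does ∘ P?)

  ∈-subsetOf⁺ : ∀ {x} → P x → x ∈ subsetOf
  ∈-subsetOf⁺ {x} p = lookup⇒[]= x _ (trans (lookup∘tabulate (does ∘ P?) x) (dec-true (P? x) p))

  ∈-subsetOf⁻ : ∀ {x} → x ∈ subsetOf → P x
  ∈-subsetOf⁻ {x} q with P? x | trans (sym (lookup∘tabulate (does ∘ P?) x)) ([]=⇒lookup q)
  ... | yes p | _  = p
  ... | no _  | ()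

-- The enumeration behind `σ` is complete, so a single induced P₄ already makes `σ` positive.
∈-subsets : ∀ {n} (X : Subset n) → X ∈ˡ subsets n
∈-subsets []            = here refl
∈-subsets (outside ∷ X) = ∈-++⁺ˡ (∈-map⁺ (outside ∷_) (∈-subsets X))
∈-subsets (inside  ∷ X) = ∈-++⁺ʳ _ (∈-map⁺ (inside ∷_) (∈-subsets X))

length≥1⇒∈ : ∀ {A : Set} {xs : List A} → 1 ≤ length xs → ∃[ x ] x ∈ˡ xs
length≥1⇒∈ {xs = x ∷ _} _ = x , here refl

if-yes : ∀ {A B : Set} (a? : Dec A) {x y : B} → A → (if does a? then x else y) ≡ x
if-yes (yes _) _ = refl
if-yes (no ¬a) a = ⊥-elim (¬a a)

if-no : ∀ {A B : Set} (a? : Dec A) {x y : B} → ¬ A → (if does a? then x else y) ≡ y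
if-no (yes a) ¬a = ⊥-elim (¬a a)
if-no (no _)  _  = refl

both : ∀ {A B : Set} → A → B → A ⇔ B
both a b = mk⇔ (λ _ → b) (λ _ → a)

neither : ∀ {A B : Set} → ¬ A → ¬ B → A ⇔ B
neither ¬a ¬b = mk⇔ (⊥-elim ∘ ¬a) (⊥-elim ∘ ¬b)

module _ {n} {R : Rel (Fin n) 0ℓ} (R? : Decidable R) (u : Fin n) where

  -- Holding the component of `u` as a `Subset` makes membership decidable, which the later case
  -- distinctions rely on.
  record ReachableSet : Set where
    field
      set       : Subset n
      source    : u ∈ set
      reachable : ∀ {x} → x ∈ set → Star R u x
      closed    : ∀ {x y} → x ∈ set → R x y → y ∈ set

  -- Saturation from the singleton of `u`: while some related pair leaves `X`, its endpoint is
  -- added. Strict growth inside a finite set terminates, and a set without an exit is closed.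
  reachableSet : ReachableSet
  reachableSet = grow ⁅ u ⁆ (⊃-wellFounded _) (x∈⁅x⁆ u)
    (λ p → subst (Star R u) (sym (x∈⁅y⁆⇒x≡y u p)) ε)
    where
    grow : ∀ X → Acc _ X → u ∈ X → (∀ {x} → x ∈ X → Star R u x) → ReachableSet
    grow X (acc rec) u∈X reach
      with any? (λ x → any? (λ y → (x ∈? X) ×-dec R? x y ×-dec ¬? (y ∈? X)))
    ... | no ∄exit = record
      { set = X ; source = u∈X ; reachable = reach
      ; closed = λ {x} {y} x∈X r → decidable-stable (y ∈? X) λ y∉X → ∄exit (x , y , x∈X , r , y∉X) }
    ... | yes (x , y , x∈X , r , y∉X) =
      grow (X ∪ ⁅ y ⁆) (rec ((λ {_} → p⊆p∪q ⁅ y ⁆) , y , q⊆p∪q X ⁅ y ⁆ (x∈⁅x⁆ y) , y∉X))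
           (p⊆p∪q ⁅ y ⁆ u∈X)
           (λ z∈ → [ reach
                   , (λ q → subst (Star R u) (sym (x∈⁅y⁆⇒x≡y y q)) (reach x∈X ◅◅ r ◅ ε))
                   ]′ (x∈p∪q⁻ X ⁅ y ⁆ z∈))

-- 2-switches and induced P₄'s

quadList : ∀ {N} → Fin N → Fin N → Fin N → Fin N → List (Fin N)
quadList a b c d = a ∷ b ∷ c ∷ d ∷ []

AgreeOn : ∀ {N} → Subset N → Graph N → Graph N → Set
AgreeOn X G H = ∀ {u v} → u ∈ X → v ∈ X → E G u v ⇔ E H u v

module _ {N} {G H : Graph N} {X : Subset N} (agree : AgreeOn X G H) where

  TwoSwitch-resp : ∀ {a b c d} → All (_∈ X) (quadList a b c d) →
                   TwoSwitch G a b c d → TwoSwitch H a b c d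
  TwoSwitch-resp (a ∷ b ∷ c ∷ d ∷ []) s = record
    { distinct = distinct
    ; ab∈E = to (agree a b) ab∈E
    ; cd∈E = to (agree c d) cd∈E
    ; ac∉E = ac∉E ∘ from (agree a c)
    ; bd∉E = bd∉E ∘ from (agree b d)
    }
    where open TwoSwitch s

  -- The labelling that exhibits `G [ X ]` as P₄ serves for `H [ X ]` unchanged, since only edges
  -- between vertices of `X` enter.
  InducesP₄-resp : X ⊆ V H → InducesP₄ G X → InducesP₄ H X
  InducesP₄-resp X⊆H (X⊆G , iso) with toLabelling (G [ X ]) iso
  ... | a , b , c , d , mem , sur , inj , edg = X⊆H , fromLabelling (H [ X ])
    ( (λ i → x∈p∩q⁺ (X⊆H (∈X i) , ∈X i))
    , (λ v v∈ → sur v (x∈p∩q⁺ (X⊆G (proj₂ (x∈p∩q⁻ (V H) X v∈)) , proj₂ (x∈p∩q⁻ (V H) X v∈))))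
    , inj
    , λ i j → mk⇔ (λ (e , p , q) → to (edg i j) (from (agree p q) e , p , q))
                  (λ e → let (e′ , p , q) = from (edg i j) e in to (agree p q) e′ , p , q))
    where
    ∈X : ∀ i → quad (G [ X ]) a b c d i ∈ X
    ∈X i = proj₂ (x∈p∩q⁻ (V G) X (mem i))

module _ {N} {G : Graph N} where

  -- This symmetry and the next generate a Klein four-group, which can bring any participant to the
  -- first position; confinement then has to be argued for `a` alone.
  TwoSwitch-flip : ∀ {a b c d} → TwoSwitch G a b c d → TwoSwitch G b a d c
  TwoSwitch-flip s with TwoSwitch.distinct s
  ... | (ab ∷ ac ∷ ad ∷ []) ∷ (bc ∷ bd ∷ []) ∷ (cd ∷ []) ∷ [] ∷ [] = record
    { distinct = (≢-sym ab ∷ bd ∷ bc ∷ []) ∷ (ad ∷ ac ∷ []) ∷ (≢-sym cd ∷ []) ∷ [] ∷ []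
    ; ab∈E = E-sym G ab∈E ; cd∈E = E-sym G cd∈E ; ac∉E = bd∉E ; bd∉E = ac∉E }
    where open TwoSwitch s

  TwoSwitch-rotate : ∀ {a b c d} → TwoSwitch G a b c d → TwoSwitch G c d a b
  TwoSwitch-rotate s with TwoSwitch.distinct s
  ... | (ab ∷ ac ∷ ad ∷ []) ∷ (bc ∷ bd ∷ []) ∷ (cd ∷ []) ∷ [] ∷ [] = record
    { distinct = (cd ∷ ≢-sym ac ∷ ≢-sym bc ∷ []) ∷ (≢-sym ad ∷ ≢-sym bd ∷ []) ∷ (ab ∷ []) ∷ [] ∷ []
    ; ab∈E = cd∈E ; cd∈E = ab∈E ; ac∉E = ac∉E ∘ E-sym G ; bd∉E = bd∉E ∘ E-sym G }
    where open TwoSwitch s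

  TwoSwitch⇒∈V : ∀ {a b c d} → TwoSwitch G a b c d → All (_∈ V G) (quadList a b c d)
  TwoSwitch⇒∈V s = E⇒∈V G ab∈E ∷ E⇒∈V G (E-sym G ab∈E) ∷ E⇒∈V G cd∈E ∷ E⇒∈V G (E-sym G cd∈E) ∷ []
    where open TwoSwitch s

  -- Read along the path, the two end edges are present and the two pairs at distance two are
  -- absent. Covering all of `X` lets statements about 2-switches carry over to whole P₄'s.
  InducesP₄⇒TwoSwitch : ∀ {X} → InducesP₄ G X → ∃[ a ] ∃[ b ] ∃[ c ] ∃[ d ]
    TwoSwitch G a b c d × (∀ {x} → x ∈ X → x ∈ˡ quadList a b c d)
  InducesP₄⇒TwoSwitch {X} (X⊆G , iso) with toLabelling (G [ X ]) iso
  ... | a , b , c , d , mem , sur , inj , edg = a , b , c , d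
    , record
      { distinct = (apart 0F 1F (λ ()) ∷ apart 0F 2F (λ ()) ∷ apart 0F 3F (λ ()) ∷ [])
                 ∷ (apart 1F 2F (λ ()) ∷ apart 1F 3F (λ ()) ∷ [])
                 ∷ (apart 2F 3F (λ ()) ∷ []) ∷ [] ∷ []
      ; ab∈E = proj₁ (from (edg 0F 1F) (from-yes (E? P₄ 0F 1F)))
      ; cd∈E = proj₁ (from (edg 2F 3F) (from-yes (E? P₄ 2F 3F)))
      ; ac∉E = λ e → from-no (E? P₄ 0F 2F) (to (edg 0F 2F) (e , ∈X 0F , ∈X 2F))
      ; bd∉E = λ e → from-no (E? P₄ 1F 3F) (to (edg 1F 3F) (e , ∈X 1F , ∈X 3F))
      }
    , λ {x} x∈X → let (i , fi≡x) = sur x (x∈p∩q⁺ (X⊆G x∈X , x∈X)) in subst (_∈ˡ _) fi≡x (∈ˡ-quad i)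
    where
    f : Fin 4 → Fin N
    f = quad (G [ X ]) a b c d

    ∈X : ∀ i → f i ∈ X
    ∈X i = proj₂ (x∈p∩q⁻ (V G) X (mem i))

    apart : ∀ i j → i ≢ j → f i ≢ f j
    apart i j i≢j eq = i≢j (inj i j eq)

    ∈ˡ-quad : ∀ i → f i ∈ˡ quadList a b c d
    ∈ˡ-quad 0F = here refl
    ∈ˡ-quad 1F = there (here refl)
    ∈ˡ-quad 2F = there (there (here refl))
    ∈ˡ-quad 3F = there (there (there (here refl)))

  -- The assumed inequalities concern the nonadjacent pairs; adjacent vertices differ by
  -- irreflexivity. `X` is the image of the labelling, so surjectivity is immediate.
  path⇒InducesP₄ : ∀ {a b c d} → a ≢ c → a ≢ d → b ≢ d →
    E G a b → E G b c → E G c d → ¬ E G a c → ¬ E G a d → ¬ E G b d →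
    ∃[ X ] InducedP₄Through G a d X
  path⇒InducesP₄ {a} {b} {c} {d} a≢c a≢d b≢d ab bc cd ¬ac ¬ad ¬bd =
    X , (X⊆G , fromLabelling (G [ X ])
          ( (λ i → x∈p∩q⁺ (∈G i , ∈X i))
          , (λ v v∈ → ∈-subsetOf⁻ image? (proj₂ (x∈p∩q⁻ (V G) X v∈)))
          , lookup-injective distinct
          , edg))
      , ∈X 0F , ∈X 3F
    where
    f : Fin 4 → Fin N
    f = quad G a b c d

    image? : ∀ v → Dec (∃[ i ] f i ≡ v)
    image? v = any? λ i → f i ≟ᶠ v

    X : Subset N
    X = subsetOf image?

    ∈X : ∀ i → f i ∈ X
    ∈X i = ∈-subsetOf⁺ image? (i , refl)

    ∈G : ∀ i → f i ∈ V G
    ∈G 0F = E⇒∈V G ab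
    ∈G 1F = E⇒∈V G bc
    ∈G 2F = E⇒∈V G cd
    ∈G 3F = E⇒∈V G (E-sym G cd)

    X⊆G : X ⊆ V G
    X⊆G v∈X = let (i , eq) = ∈-subsetOf⁻ image? v∈X in subst (_∈ V G) eq (∈G i)

    E⇒≢ : ∀ {x y} → E G x y → x ≢ y
    E⇒≢ e refl = E-irr G e

    distinct : VecAllPairs.AllPairs _≢_ (a ∷ b ∷ c ∷ d ∷ [])
    distinct = (E⇒≢ ab VecAll.∷ a≢c VecAll.∷ a≢d VecAll.∷ VecAll.[])
      VecAllPairs.∷ (E⇒≢ bc VecAll.∷ b≢d VecAll.∷ VecAll.[])
      VecAllPairs.∷ (E⇒≢ cd VecAll.∷ VecAll.[])
      VecAllPairs.∷ VecAll.[] VecAllPairs.∷ VecAllPairs.[]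

    SameEdge : Fin 4 → Fin 4 → Set
    SameEdge i j = E (G [ X ]) (f i) (f j) ⇔ E P₄ i j

    present : ∀ i j → E P₄ i j → E G (f i) (f j) → SameEdge i j
    present i j p e = both (e , ∈X i , ∈X j) p

    absent : ∀ i j → ¬ E P₄ i j → ¬ E G (f i) (f j) → SameEdge i j
    absent i j ¬p ¬e = neither (¬e ∘ proj₁) ¬p

    flip : ∀ i j → SameEdge i j → SameEdge j i
    flip i j eq = mk⇔ (E-sym P₄ {i} {j} ∘ to eq ∘ E-sym (G [ X ]))
                      (E-sym (G [ X ]) ∘ from eq ∘ E-sym P₄ {j} {i})

    edg : ∀ i j → SameEdge i j
    edg 0F 0F = absent 0F 0F (E-irr P₄ {0F}) (E-irr G)
    edg 1F 1F = absent 1F 1F (E-irr P₄ {1F}) (E-irr G)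
    edg 2F 2F = absent 2F 2F (E-irr P₄ {2F}) (E-irr G)
    edg 3F 3F = absent 3F 3F (E-irr P₄ {3F}) (E-irr G)
    edg 0F 1F = present 0F 1F (from-yes (E? P₄ 0F 1F)) ab
    edg 1F 2F = present 1F 2F (from-yes (E? P₄ 1F 2F)) bc
    edg 2F 3F = present 2F 3F (from-yes (E? P₄ 2F 3F)) cd
    edg 0F 2F = absent 0F 2F (from-no (E? P₄ 0F 2F)) ¬ac
    edg 0F 3F = absent 0F 3F (from-no (E? P₄ 0F 3F)) ¬ad
    edg 1F 3F = absent 1F 3F (from-no (E? P₄ 1F 3F)) ¬bd
    edg 1F 0F = flip 0F 1F (edg 0F 1F)
    edg 2F 1F = flip 1F 2F (edg 1F 2F)
    edg 3F 2F = flip 2F 3F (edg 2F 3F)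
    edg 2F 0F = flip 0F 2F (edg 0F 2F)
    edg 3F 0F = flip 0F 3F (edg 0F 3F)
    edg 3F 1F = flip 1F 3F (edg 1F 3F)

-- Split graphs

module _ {N} (S : SplitGraph N) where

  private G = graph S

  V⇒K⊎I : ∀ {v} → v ∈ V G → v ∈ K S ⊎ v ∈ I S
  V⇒K⊎I v∈ = x∈p∪q⁻ (K S) (I S) (subst (_ ∈_) (V≡K∪I S) v∈)

  I-neighbour : ∀ {u v} → u ∈ I S → E G u v → v ∈ K S
  I-neighbour u∈I e with V⇒K⊎I (E⇒∈V G (E-sym G e))
  ... | inj₁ v∈K = v∈K
  ... | inj₂ v∈I = ⊥-elim (independent S u∈I v∈I e)

  -- Two distinct clique vertices are adjacent, whereas `a` and `c` are not.
  TwoSwitch-meets-I : ∀ {a b c d} → TwoSwitch G a b c d → a ∈ I S ⊎ c ∈ I S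
  TwoSwitch-meets-I s
    with V⇒K⊎I (E⇒∈V G (TwoSwitch.ab∈E s)) | V⇒K⊎I (E⇒∈V G (TwoSwitch.cd∈E s)) | TwoSwitch.distinct s
  ... | inj₂ a∈I | _        | _ = inj₁ a∈I
  ... | _        | inj₂ c∈I | _ = inj₂ c∈I
  ... | inj₁ a∈K | inj₁ c∈K | (_ ∷ a≢c ∷ _) ∷ _ = ⊥-elim (TwoSwitch.ac∉E s (clique S a∈K c∈K a≢c))

  mult-in : ∀ {u v} → DistinctIn (I S) u v → mult (Φ S) u v ≡ σ S u v
  mult-in {u} {v} = if-yes (distinctIn? (I S) u v)

  mult-out : ∀ {u v} → ¬ DistinctIn (I S) u v → mult (Φ S) u v ≡ 0
  mult-out {u} {v} = if-no (distinctIn? (I S) u v)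

  -- Puts an edge of `Φ S` into the form to which confinement of 2-switches applies.
  mult≥1⇒TwoSwitch : ∀ {u v} → 1 ≤ mult (Φ S) u v → ∃[ a ] ∃[ b ] ∃[ c ] ∃[ d ]
    TwoSwitch G a b c d × u ∈ˡ quadList a b c d × v ∈ˡ quadList a b c d
  mult≥1⇒TwoSwitch {u} {v} p with distinctIn? (I S) u v
  ... | no ¬uv with () ← subst (1 ≤_) (mult-out ¬uv) p
  ... | yes uv with (X , X∈) ← length≥1⇒∈ (subst (1 ≤_) (mult-in uv) p)
    with (_ , P₄X , u∈X , v∈X) ← ∈-filter⁻ (inducedP₄Through? G u v) {xs = subsets N} X∈
    with (a , b , c , d , s , ⊆quad) ← InducesP₄⇒TwoSwitch P₄X
    = a , b , c , d , s , ⊆quad u∈X , ⊆quad v∈X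

  -- Neighbourhood inclusion, incomparability and cuts.

  infix 4 _⊑_ _⊑?_

  -- On `I S` this is the vicinal preorder.
  _⊑_ : Fin N → Fin N → Set
  x ⊑ y = ∀ k → E G x k → E G y k

  _⊑?_ : Decidable _⊑_
  x ⊑? y = all? λ k → E? G x k →-dec E? G y k

  ⋢⇒neighbour : ∀ {x y} → ¬ x ⊑ y → ∃[ k ] E G x k × ¬ E G y k
  ⋢⇒neighbour {x} {y} x⋢y with ¬∀⟶∃¬ N _ (λ k → E? G x k →-dec E? G y k) x⋢y
  ... | k , ¬imp = k , decidable-stable (E? G x k) (λ ¬e → ¬imp (⊥-elim ∘ ¬e)) , λ e → ¬imp (λ _ → e)

  Incomparable : Rel (Fin N) 0ℓ
  Incomparable x y = x ∈ I S × y ∈ I S × ¬ x ⊑ y × ¬ y ⊑ x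

  incomparable? : Decidable Incomparable
  incomparable? x y = (x ∈? I S) ×-dec (y ∈? I S) ×-dec ¬? (x ⊑? y) ×-dec ¬? (y ⊑? x)

  comparable : ∀ {x y} → x ∈ I S → y ∈ I S → ¬ Incomparable x y → x ⊑ y ⊎ y ⊑ x
  comparable {x} {y} x∈I y∈I ¬inc with x ⊑? y | y ⊑? x
  ... | yes x⊑y | _       = inj₁ x⊑y
  ... | no _    | yes y⊑x = inj₂ y⊑x
  ... | no x⋢y  | no y⋢x  = ⊥-elim (¬inc (x∈I , y∈I , x⋢y , y⋢x))

  -- A neighbour `a` of `u` alone and a neighbour `b` of `v` alone both lie in the clique, so `u`,
  -- `a`, `b`, `v` is an induced path.
  Incomparable⇒mult≥1 : ∀ {u v} → Incomparable u v → 1 ≤ mult (Φ S) u v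
  Incomparable⇒mult≥1 {u} {v} (u∈I , v∈I , u⋢v , v⋢u)
    with ⋢⇒neighbour u⋢v | ⋢⇒neighbour v⋢u
  ... | a , ua , ¬va | b , vb , ¬ub =
    let (X , P₄X) = path⇒InducesP₄ {G = G} (λ { refl → K-I S b∈K u∈I }) u≢v
                      (λ { refl → K-I S a∈K v∈I }) ua ab (E-sym G vb)
                      ¬ub (independent S u∈I v∈I) (¬va ∘ E-sym G) in
    subst (1 ≤_) (sym (mult-in (u∈I , v∈I , u≢v)))
      (∈-length (∈-filter⁺ (inducedP₄Through? G u v) (∈-subsets X) P₄X))
    where
    a∈K : a ∈ K S
    a∈K = I-neighbour u∈I ua

    b∈K : b ∈ K S
    b∈K = I-neighbour v∈I vb

    u≢v : u ≢ v
    u≢v refl = ¬va ua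

    ab : E G a b
    ab = clique S a∈K b∈K λ { refl → ¬va vb }
  -- The split factor is `A` with its neighbourhood `K′`. Vertices of `A` have no neighbours outside
  -- `K′`; a vertex of `K′` is adjacent to the rest of `K S` by the clique property and to every `b`
  -- of `I S` outside `A` because it is a neighbour of some `a ⊑ b`. This is the edge pattern of a
  -- composition.
  cut⇒Decomposable : ∀ {A} → A ⊆ I S → (∀ {a b} → a ∈ A → b ∈ I S → b ∉ A → a ⊑ b) →
    Nonempty A → ∃[ b ] b ∈ I S × b ∉ A → Decomposable G
  cut⇒Decomposable {A} A⊆I below (a₀ , a₀∈A) (b₀ , b₀∈I , b₀∉A) =
    T , G [ ∁ X ] , disj
    , (a₀ , x∈p∩q⁺ (I⇒V S (A⊆I a₀∈A) , A⊆X a₀∈A))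
    , (b₀ , x∈p∩q⁺ (I⇒V S b₀∈I , x∉p⇒x∈∁p (b₀∉A ∘ I∩X⊆A b₀∈I)))
    , record { V-≡ = ⊆-antisym split unsplit ; E-⇔ = λ u v → mk⇔ splitE unsplitE }
    where
    neighbour? : ∀ k → Dec (∃[ a ] a ∈ A × E G a k)
    neighbour? k = any? λ a → (a ∈? A) ×-dec E? G a k

    K′ X : Subset N
    K′ = subsetOf neighbour?
    X = K′ ∪ A

    A⊆X : A ⊆ X
    A⊆X = q⊆p∪q K′ A

    K′⊆K : K′ ⊆ K S
    K′⊆K k∈ = let (_ , a∈A , e) = ∈-subsetOf⁻ neighbour? k∈ in I-neighbour (A⊆I a∈A) e

    I∩X⊆A : ∀ {v} → v ∈ I S → v ∈ X → v ∈ A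
    I∩X⊆A v∈I v∈X = [ (λ k → ⊥-elim (K-I S (K′⊆K k) v∈I)) , (λ a → a) ]′ (x∈p∪q⁻ K′ A v∈X)

    X⊆V : X ⊆ V G
    X⊆V v∈X = [ K⇒V S ∘ K′⊆K , I⇒V S ∘ A⊆I ]′ (x∈p∪q⁻ K′ A v∈X)

    T : SplitGraph N
    T = record
      { graph       = G [ X ]
      ; K           = K′
      ; I           = A
      ; V≡K∪I       = ⊆-antisym (proj₂ ∘ x∈p∩q⁻ (V G) X) (λ p → x∈p∩q⁺ (X⊆V p , p))
      ; K-I         = λ k a → K-I S (K′⊆K k) (A⊆I a)
      ; clique      = λ k l u≢v → clique S (K′⊆K k) (K′⊆K l) u≢v , p⊆p∪q A k , p⊆p∪q A l
      ; independent = λ a b (e , _) → independent S (A⊆I a) (A⊆I b) e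
      }

    H : Graph N
    H = G [ ∁ X ]

    disj : Disjoint (graph T) H
    disj v∈T v∈H = x∈∁p⇒x∉p (proj₂ (x∈p∩q⁻ (V G) (∁ X) v∈H)) (proj₂ (x∈p∩q⁻ (V G) X v∈T))

    C : Graph N
    C = compose T H disj

    split : V G ⊆ V C
    split {v} v∈ with v ∈? X
    ... | yes p = x∈p∪q⁺ (inj₁ (x∈p∩q⁺ (v∈ , p)))
    ... | no ¬p = x∈p∪q⁺ (inj₂ (x∈p∩q⁺ (v∈ , x∉p⇒x∈∁p ¬p)))

    unsplit : V C ⊆ V G
    unsplit v∈ = [ proj₁ ∘ x∈p∩q⁻ (V G) X , proj₁ ∘ x∈p∩q⁻ (V G) (∁ X) ]′
                 (x∈p∪q⁻ (V (graph T)) (V H) v∈)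

    crossing : ∀ {u v} → E G u v → u ∈ X → v ∉ X → u ∈ K′ × v ∈ V H
    crossing e u∈X v∉X with x∈p∪q⁻ K′ A u∈X
    ... | inj₁ k = k , x∈p∩q⁺ (E⇒∈V G (E-sym G e) , x∉p⇒x∈∁p v∉X)
    -- An edge leaving `X` cannot start in `A`, since its other end would then belong to `K′`.
    ... | inj₂ a = ⊥-elim (v∉X (p⊆p∪q A (∈-subsetOf⁺ neighbour? (_ , a , e))))

    splitE : ∀ {u v} → E G u v → E C u v
    splitE {u} {v} e with u ∈? X | v ∈? X
    ... | yes p | yes q = inj₁ (e , p , q)
    ... | yes p | no ¬q = inj₂ (inj₂ (inj₁ (crossing e p ¬q)))
    ... | no ¬p | yes q = inj₂ (inj₂ (inj₂ (crossing (E-sym G e) q ¬p)))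
    ... | no ¬p | no ¬q = inj₂ (inj₁ (e , x∉p⇒x∈∁p ¬p , x∉p⇒x∈∁p ¬q))

    joined : ∀ {u v} → u ∈ K′ → v ∈ V H → E G u v
    joined {u} {v} k v∈H with x∈p∩q⁻ (V G) (∁ X) v∈H
    ... | v∈G , v∈∁X with V⇒K⊎I v∈G
    ... | inj₁ v∈K = clique S (K′⊆K k) v∈K λ { refl → x∈∁p⇒x∉p v∈∁X (p⊆p∪q A k) }
    ... | inj₂ v∈I = let (_ , a , e) = ∈-subsetOf⁻ neighbour? k in
      E-sym G (below a v∈I (x∈∁p⇒x∉p v∈∁X ∘ A⊆X) u e)

    unsplitE : ∀ {u v} → E C u v → E G u v
    unsplitE (inj₁ (e , _))                   = e
    unsplitE (inj₂ (inj₁ (e , _)))            = e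
    unsplitE (inj₂ (inj₂ (inj₁ (k , v∈H)))) = joined k v∈H
    unsplitE (inj₂ (inj₂ (inj₂ (k , u∈H)))) = E-sym G (joined k u∈H)

  -- Each vertex outside a component Y of the incomparability relation compares
  -- in the same way with all of Y, so those below Y, with or without Y itself,
  -- form an initial segment.
  Indecomposable⇒Connected : Indecomposable G → Connected (underlying (Φ S))
  Indecomposable⇒Connected indec {u} {v} u∈I v∈I = conclude (v ∈? Y)
    where
    open ReachableSet (reachableSet incomparable? u) renaming (set to Y)

    Outside : Fin N → Set
    Outside y = y ∈ I S × y ∉ Y

    compare : ∀ {x y} → x ∈ Y → x ∈ I S → Outside y → x ⊑ y ⊎ y ⊑ x
    compare x∈Y x∈I (y∈I , y∉Y) = comparable x∈I y∈I (y∉Y ∘ closed x∈Y)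

    ⊑-trans : ∀ {x y z} → x ⊑ y → y ⊑ z → x ⊑ z
    ⊑-trans p q k = q k ∘ p k

    -- Along a path of incomparable vertices the side of `y` cannot change: `z ⊑ y ⊑ w` would make
    -- the consecutive vertices `z` and `w` comparable. The next lemma is the dual.
    below-from : ∀ {x y z} → Outside y → z ∈ Y → z ⊑ y → Star Incomparable z x → x ⊑ y
    below-from out z∈Y z⊑y ε = z⊑y
    below-from out z∈Y z⊑y (r@(_ , w∈I , z⋢w , _) ◅ rs) with compare (closed z∈Y r) w∈I out
    ... | inj₁ w⊑y = below-from out (closed z∈Y r) w⊑y rs
    ... | inj₂ y⊑w = ⊥-elim (z⋢w (⊑-trans z⊑y y⊑w))

    above-from : ∀ {x y z} → Outside y → z ∈ Y → y ⊑ z → Star Incomparable z x → y ⊑ x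
    above-from out z∈Y y⊑z ε = y⊑z
    above-from out z∈Y y⊑z (r@(_ , w∈I , _ , w⋢z) ◅ rs) with compare (closed z∈Y r) w∈I out
    ... | inj₁ w⊑y = ⊥-elim (w⋢z (⊑-trans w⊑y y⊑z))
    ... | inj₂ y⊑w = above-from out (closed z∈Y r) y⊑w rs

    above-u : ∀ {y} → Outside y → ¬ y ⊑ u → u ⊑ y
    above-u out y⋢u = [ (λ u⊑y → u⊑y) , ⊥-elim ∘ y⋢u ]′ (compare source u∈I out)

    lower? : ∀ y → Dec (Outside y × y ⊑ u)
    lower? y = ((y ∈? I S) ×-dec ¬? (y ∈? Y)) ×-dec (y ⊑? u)

    lowerOrY? : ∀ y → Dec (y ∈ I S × (y ∈ Y ⊎ y ⊑ u))
    lowerOrY? y = (y ∈? I S) ×-dec ((y ∈? Y) ⊎-dec (y ⊑? u))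

    -- The segment is chosen to separate `u` from `v`: without `Y` it contains `v` and misses `u`
    -- when `v ⊑ u`; with `Y` it contains `u` and misses `v` otherwise.
    cut : v ∉ Y → Dec (v ⊑ u) → Decomposable G
    cut v∉Y (yes v⊑u) = cut⇒Decomposable {subsetOf lower?} (proj₁ ∘ proj₁ ∘ ∈-subsetOf⁻ lower?) below
      (v , ∈-subsetOf⁺ lower? ((v∈I , v∉Y) , v⊑u))
      (u , u∈I , λ u∈ → proj₂ (proj₁ (∈-subsetOf⁻ lower? u∈)) source)
      where
      below : ∀ {a b} → a ∈ subsetOf lower? → b ∈ I S → b ∉ subsetOf lower? → a ⊑ b
      below {b = b} a∈ b∈I b∉ with ∈-subsetOf⁻ lower? a∈ | b ∈? Y
      ... | out , a⊑u | yes b∈Y = above-from out source a⊑u (reachable b∈Y)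
      -- Here `b` is outside both `Y` and the segment, hence not below `u`, hence above it; `u`
      -- links `a` to `b`.
      ... | _   , a⊑u | no b∉Y =
        ⊑-trans a⊑u (above-u (b∈I , b∉Y) λ b⊑u → b∉ (∈-subsetOf⁺ lower? ((b∈I , b∉Y) , b⊑u)))
    cut v∉Y (no v⋢u) = cut⇒Decomposable {subsetOf lowerOrY?} (proj₁ ∘ ∈-subsetOf⁻ lowerOrY?) below
      (u , ∈-subsetOf⁺ lowerOrY? (u∈I , inj₁ source))
      (v , v∈I , λ v∈ → [ v∉Y , v⋢u ]′ (proj₂ (∈-subsetOf⁻ lowerOrY? v∈)))
      where
      below : ∀ {a b} → a ∈ subsetOf lowerOrY? → b ∈ I S → b ∉ subsetOf lowerOrY? → a ⊑ b
      below {b = b} a∈ b∈I b∉ with ∈-subsetOf⁻ lowerOrY? a∈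
      ... | _ , inj₁ a∈Y = below-from out source u⊑b (reachable a∈Y)
        where
        out : Outside b
        out = b∈I , λ b∈Y → b∉ (∈-subsetOf⁺ lowerOrY? (b∈I , inj₁ b∈Y))

        u⊑b : u ⊑ b
        u⊑b = above-u out λ b⊑u → b∉ (∈-subsetOf⁺ lowerOrY? (b∈I , inj₂ b⊑u))
      ... | _ , inj₂ a⊑u = ⊑-trans a⊑u (above-u
        (b∈I , λ b∈Y → b∉ (∈-subsetOf⁺ lowerOrY? (b∈I , inj₁ b∈Y)))
        λ b⊑u → b∉ (∈-subsetOf⁺ lowerOrY? (b∈I , inj₂ b⊑u)))

    conclude : Dec (v ∈ Y) → Star (E (underlying (Φ S))) u v
    conclude (yes v∈Y) = Star.map Incomparable⇒mult≥1 (reachable v∈Y)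
    conclude (no v∉Y)  = ⊥-elim (indec (cut v∉Y (v ⊑? u)))

-- 2-switches in a composition

module _ {N} (T : SplitGraph N) (H : Graph N) (disj : Disjoint (graph T) H) where

  private
    C = compose T H disj

  V-compose : ∀ {v} → v ∈ V C → v ∈ V (graph T) ⊎ v ∈ V H
  V-compose = x∈p∪q⁻ (V (graph T)) (V H)

  agree-left : AgreeOn (V (graph T)) C (graph T)
  agree-left {u} {v} u∈T v∈T = mk⇔
    (λ { (inj₁ e)                        → e
       ; (inj₂ (inj₁ e))                 → ⊥-elim (disj u∈T (E⇒∈V H e))
       ; (inj₂ (inj₂ (inj₁ (_ , v∈H)))) → ⊥-elim (disj v∈T v∈H)
       ; (inj₂ (inj₂ (inj₂ (_ , u∈H)))) → ⊥-elim (disj u∈T u∈H) })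
    inj₁

  agree-right : AgreeOn (V H) C H
  agree-right {u} {v} u∈H v∈H = mk⇔
    (λ { (inj₁ e)                      → ⊥-elim (disj (E⇒∈V (graph T) e) u∈H)
       ; (inj₂ (inj₁ e))               → e
       ; (inj₂ (inj₂ (inj₁ (k , _)))) → ⊥-elim (disj (K⇒V T k) u∈H)
       ; (inj₂ (inj₂ (inj₂ (k , _)))) → ⊥-elim (disj (K⇒V T k) v∈H) })
    (inj₂ ∘ inj₁)

  I-neighbour-compose : ∀ {u v} → u ∈ I T → E C u v → v ∈ K T
  I-neighbour-compose u∈I (inj₁ e)                      = I-neighbour T u∈I e
  I-neighbour-compose u∈I (inj₂ (inj₁ e))               = ⊥-elim (disj (I⇒V T u∈I) (E⇒∈V H e))
  I-neighbour-compose u∈I (inj₂ (inj₂ (inj₁ (k , _)))) = ⊥-elim (K-I T k u∈I)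
  I-neighbour-compose u∈I (inj₂ (inj₂ (inj₂ (k , _)))) = k

  K-nonneighbour : ∀ {u v} → u ∈ K T → v ∈ V C → ¬ E C u v → v ∈ V (graph T)
  K-nonneighbour u∈K v∈C ¬e with V-compose v∈C
  ... | inj₁ v∈T = v∈T
  ... | inj₂ v∈H = ⊥-elim (¬e (inj₂ (inj₂ (inj₁ (u∈K , v∈H)))))

  -- Everything in `H` is joined to `K T`. So `c`, not adjacent to `a`, lies in `T`, and in `I T`
  -- rather than `K T`; its neighbour `d` is therefore in `K T`, and `b`, not adjacent to `d`, lies
  -- in `T` as well.
  TwoSwitch-from-K : ∀ {a b c d} → TwoSwitch C a b c d → a ∈ K T →
                     All (_∈ V (graph T)) (quadList a b c d)
  TwoSwitch-from-K s a∈K with TwoSwitch⇒∈V {G = C} s | TwoSwitch.distinct s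
  ... | _ ∷ b∈C ∷ c∈C ∷ _ | (_ ∷ a≢c ∷ _) ∷ _ with K-nonneighbour a∈K c∈C (TwoSwitch.ac∉E s)
  ... | c∈T with V⇒K⊎I T c∈T
  ... | inj₁ c∈K = ⊥-elim (TwoSwitch.ac∉E s (inj₁ (clique T a∈K c∈K a≢c)))
  ... | inj₂ c∈I with I-neighbour-compose c∈I (TwoSwitch.cd∈E s)
  ... | d∈K = K⇒V T a∈K ∷ K-nonneighbour d∈K b∈C (TwoSwitch.bd∉E s ∘ E-sym C) ∷ c∈T ∷ K⇒V T d∈K ∷ []

  -- If `a` is in `I T`, its neighbour `b` is in `K T`, and the flip puts `b` first.
  TwoSwitch-from-left : ∀ {a b c d} → TwoSwitch C a b c d → a ∈ V (graph T) →
                        All (_∈ V (graph T)) (quadList a b c d)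
  TwoSwitch-from-left s a∈T with V⇒K⊎I T a∈T
  ... | inj₁ a∈K = TwoSwitch-from-K s a∈K
  ... | inj₂ a∈I with TwoSwitch-from-K (TwoSwitch-flip {G = C} s)
                        (I-neighbour-compose a∈I (TwoSwitch.ab∈E s))
  ... | b∈ ∷ a∈ ∷ d∈ ∷ c∈ ∷ [] = a∈ ∷ b∈ ∷ c∈ ∷ d∈ ∷ []

  -- If `a` is not in `T`, neither is any other participant: moving that one to the front by a
  -- symmetry would force `a` into `T`.
  TwoSwitch-confined : ∀ {a b c d} → TwoSwitch C a b c d →
    All (_∈ V (graph T)) (quadList a b c d) ⊎ All (_∈ V H) (quadList a b c d)
  TwoSwitch-confined {a} s with a ∈? V (graph T)
  ... | yes a∈T = inj₁ (TwoSwitch-from-left s a∈T)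
  ... | no a∉T with TwoSwitch⇒∈V {G = C} s
  ... | a∈ ∷ b∈ ∷ c∈ ∷ d∈ ∷ [] = inj₂
    ( right a∈ a∉T
    ∷ right b∈ (λ b∈T → a∉T (All.lookup (TwoSwitch-from-left flipped b∈T) (there (here refl))))
    ∷ right c∈ (λ c∈T → a∉T (All.lookup (TwoSwitch-from-left rotated c∈T) (there (there (here refl)))))
    ∷ right d∈ (λ d∈T → a∉T (All.lookup (TwoSwitch-from-left (TwoSwitch-flip {G = C} rotated) d∈T)
                                        (there (there (there (here refl))))))
    ∷ [])
    where
    flipped = TwoSwitch-flip {G = C} s
    rotated = TwoSwitch-rotate {G = C} s

    right : ∀ {v} → v ∈ V C → v ∉ V (graph T) → v ∈ V H
    right v∈C v∉T = [ ⊥-elim ∘ v∉T , (λ v∈H → v∈H) ]′ (V-compose v∈C)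

  confined-left : ∀ {a b c d v} → TwoSwitch C a b c d → v ∈ˡ quadList a b c d →
    v ∈ V (graph T) → All (_∈ V (graph T)) (quadList a b c d)
  confined-left s v∈s v∈T with TwoSwitch-confined s
  ... | inj₁ inT = inT
  ... | inj₂ inH = ⊥-elim (disj v∈T (All.lookup inH v∈s))

  confined-right : ∀ {a b c d v} → TwoSwitch C a b c d → v ∈ˡ quadList a b c d →
    v ∈ V H → All (_∈ V H) (quadList a b c d)
  confined-right s v∈s v∈H with TwoSwitch-confined s
  ... | inj₁ inT = ⊥-elim (disj (All.lookup inT v∈s) v∈H)
  ... | inj₂ inH = inH

  P₄-confined-left : ∀ {X v} → InducesP₄ C X → v ∈ X → v ∈ V (graph T) → X ⊆ V (graph T)
  P₄-confined-left P₄X v∈X v∈T x∈X with InducesP₄⇒TwoSwitch P₄X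
  ... | _ , _ , _ , _ , s , ⊆quad = All.lookup (confined-left s (⊆quad v∈X) v∈T) (⊆quad x∈X)

  P₄-confined-right : ∀ {X v} → InducesP₄ C X → v ∈ X → v ∈ V H → X ⊆ V H
  P₄-confined-right P₄X v∈X v∈H x∈X with InducesP₄⇒TwoSwitch P₄X
  ... | _ , _ , _ , _ , s , ⊆quad = All.lookup (confined-right s (⊆quad v∈X) v∈H) (⊆quad x∈X)

  Active-left : Active C → Active (graph T)
  Active-left active v∈T with active (x∈p∪q⁺ (inj₁ v∈T))
  ... | a , b , c , d , s , v∈s = a , b , c , d
    , TwoSwitch-resp {G = C} agree-left (confined-left s v∈s v∈T) s , v∈s

  Active-right : Active C → Active H
  Active-right active v∈H with active (x∈p∪q⁺ (inj₂ v∈H))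
  ... | a , b , c , d , s , v∈s = a , b , c , d
    , TwoSwitch-resp {G = C} agree-right (confined-right s v∈s v∈H) s , v∈s

-- From a connected factor graph to indecomposability.

≈⇒TwoSwitch : ∀ {N} {G H : Graph N} {a b c d} → G ≈ H → TwoSwitch G a b c d → TwoSwitch H a b c d
≈⇒TwoSwitch {G = G} G≈H = TwoSwitch-resp {G = G} {X = ⊤} (λ _ _ → _≈_.E-⇔ G≈H _ _)
  (∈⊤ ∷ ∈⊤ ∷ ∈⊤ ∷ ∈⊤ ∷ [])

Active-resp : ∀ {N} {G H : Graph N} → G ≈ H → Active G → Active H
Active-resp G≈H active v∈H with active (subst (_ ∈_) (sym (_≈_.V-≡ G≈H)) v∈H)
... | a , b , c , d , s , v∈s = a , b , c , d , ≈⇒TwoSwitch G≈H s , v∈s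

-- Activity puts a vertex of `I S` into each factor, and a path of `Φ S` between them would never
-- leave the factor where it starts. The bipartition of `T` may differ from that induced by `S`, so
-- the vertices are found through 2-switches.
Connected⇒Indecomposable : ∀ {N} (S : SplitGraph N) → Active (graph S) →
  Connected (underlying (Φ S)) → Indecomposable (graph S)
Connected⇒Indecomposable {N} S active connected (T , H , disj , (t , t∈T) , (h , h∈H) , S≈C) =
  let (x , x∈I , x∈T) = I-vertex (λ {v} → confined-left T H disj {v = v})
                          (x∈p∪q⁺ (inj₁ t∈T)) t∈T
      (y , y∈I , y∈H) = I-vertex (λ {v} → confined-right T H disj {v = v})
                          (x∈p∪q⁺ (inj₂ h∈H)) h∈H
  in disj (stays (connected x∈I y∈I) x∈T) y∈H
  where
  C : Graph N
  C = compose T H disj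

  -- Abstract in the confinement property, so as to serve both factors.
  I-vertex : ∀ {X : Subset N} {w} →
    (∀ {v a b c d} → TwoSwitch C a b c d → v ∈ˡ quadList a b c d → v ∈ X → All (_∈ X) (quadList a b c d)) →
    w ∈ V C → w ∈ X → ∃[ x ] x ∈ I S × x ∈ X
  I-vertex confined w∈C w∈X with active (subst (_ ∈_) (sym (_≈_.V-≡ S≈C)) w∈C)
  ... | _ , _ , _ , _ , s , w∈s with confined (≈⇒TwoSwitch S≈C s) w∈s w∈X | TwoSwitch-meets-I S s
  ... | a∈ ∷ _            | inj₁ a∈I = _ , a∈I , a∈
  ... | _ ∷ _ ∷ c∈ ∷ _ | inj₂ c∈I = _ , c∈I , c∈

  stays : ∀ {u v} → Star (E (underlying (Φ S))) u v → u ∈ V (graph T) → v ∈ V (graph T)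
  stays ε        u∈T = u∈T
  stays (e ◅ es) u∈T with mult≥1⇒TwoSwitch S e
  ... | _ , _ , _ , _ , s , u∈s , w∈s =
    stays es (All.lookup (confined-left T H disj (≈⇒TwoSwitch S≈C s) u∈s u∈T) w∈s)

-- The factor graph of a composition.

-- Both sides count the same sets `X`: every P₄ of `C` through `u` lies in `F`, where the two graphs
-- have the same edges. Two filters of one list thus coincide.
σ-restrict : ∀ {N} (C F : SplitGraph N) → V (graph F) ⊆ V (graph C) →
  AgreeOn (V (graph F)) (graph C) (graph F) →
  ∀ {u} → (∀ {X} → InducesP₄ (graph C) X → u ∈ X → X ⊆ V (graph F)) →
  ∀ v → σ C u v ≡ σ F u v
σ-restrict {N} C F F⊆C agree {u} confined v = cong length (filter-≐
  (inducedP₄Through? (graph C) u v) (inducedP₄Through? (graph F) u v)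
  ( (λ (P₄X , u∈X , v∈X) → restrict P₄X (confined P₄X u∈X) , u∈X , v∈X)
  , (λ (P₄X , u∈X , v∈X) → extend P₄X , u∈X , v∈X))
  (subsets N))
  where
  restrict : ∀ {X} → InducesP₄ (graph C) X → X ⊆ V (graph F) → InducesP₄ (graph F) X
  restrict P₄X X⊆F =
    InducesP₄-resp {G = graph C} {H = graph F} (λ p q → agree (X⊆F p) (X⊆F q)) X⊆F P₄X

  extend : ∀ {X} → InducesP₄ (graph F) X → InducesP₄ (graph C) X
  extend P₄X@(X⊆F , _) =
    InducesP₄-resp {G = graph F} {H = graph C}
      (λ p q → ⇔-sym (agree (X⊆F p) (X⊆F q))) (F⊆C ∘ X⊆F) P₄X

module _ {N} (S T : SplitGraph N) (disj : Disjoint (graph S) (graph T)) where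

  private
    C = composeSplit S T disj

  σ-composeSplit-left : ∀ {u} v → u ∈ V (graph S) → σ C u v ≡ σ S u v
  σ-composeSplit-left v u∈S = σ-restrict C S (p⊆p∪q (V (graph T))) (agree-left S (graph T) disj)
    (λ P₄X u∈X → P₄-confined-left S (graph T) disj P₄X u∈X u∈S) v

  σ-composeSplit-right : ∀ {u} v → u ∈ V (graph T) → σ C u v ≡ σ T u v
  σ-composeSplit-right v u∈T = σ-restrict C T (q⊆p∪q (V (graph S)) (V (graph T)))
    (agree-right S (graph T) disj)
    (λ P₄X u∈X → P₄-confined-right S (graph T) disj P₄X u∈X u∈T) v

  -- The hypotheses leave only `u` and `v` in different factors, and no P₄ meets both factors.
  σ-composeSplit-cross : ∀ {u v} → DistinctIn (I C) u v →
    ¬ DistinctIn (I S) u v → ¬ DistinctIn (I T) u v → σ C u v ≡ 0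
  σ-composeSplit-cross {u} {v} (u∈I , v∈I , u≢v) ¬S ¬T = cong length
    (filter-none (inducedP₄Through? (graph C) u v)
      {xs = subsets N} (All.universal (λ X → crossP₄ (x∈p∪q⁻ (I S) (I T) u∈I) (x∈p∪q⁻ (I S) (I T) v∈I))
                         (subsets N)))
    where
    crossP₄ : ∀ {X} → u ∈ I S ⊎ u ∈ I T → v ∈ I S ⊎ v ∈ I T → ¬ InducedP₄Through (graph C) u v X
    crossP₄ (inj₁ uS) (inj₁ vS) _ = ¬S (uS , vS , u≢v)
    crossP₄ (inj₂ uT) (inj₂ vT) _ = ¬T (uT , vT , u≢v)
    crossP₄ (inj₁ uS) (inj₂ vT) (P₄X , u∈X , v∈X) =
      disj (P₄-confined-left S (graph T) disj P₄X u∈X (I⇒V S uS) v∈X) (I⇒V T vT)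
    crossP₄ (inj₂ uT) (inj₁ vS) (P₄X , u∈X , v∈X) =
      disj (I⇒V S vS) (P₄-confined-right S (graph T) disj P₄X u∈X (I⇒V T uT) v∈X)

  -- `I S` and `I T` are disjoint, so at most one summand is nonzero at any pair.
  Φ-composeSplit : Φ C ≈ₘ Φ S ⊍ Φ T
  Φ-composeSplit = record { W-≡ = refl ; mult-≡ = mult-+ }
    where
    mult-+ : ∀ u v → mult (Φ C) u v ≡ mult (Φ S) u v + mult (Φ T) u v
    mult-+ u v = cases (distinctIn? (I S) u v) (distinctIn? (I T) u v) (distinctIn? (I C) u v)
      where
      inC-left : DistinctIn (I S) u v → DistinctIn (I C) u v
      inC-left (p , q , u≢v) = x∈p∪q⁺ (inj₁ p) , x∈p∪q⁺ (inj₁ q) , u≢v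

      inC-right : DistinctIn (I T) u v → DistinctIn (I C) u v
      inC-right (p , q , u≢v) = x∈p∪q⁺ (inj₂ p) , x∈p∪q⁺ (inj₂ q) , u≢v

      cases : Dec (DistinctIn (I S) u v) → Dec (DistinctIn (I T) u v) → Dec (DistinctIn (I C) u v) →
              mult (Φ C) u v ≡ mult (Φ S) u v + mult (Φ T) u v
      cases (yes p@(u∈S , _)) _ _ = trans
        (trans (mult-in C (inC-left p))
               (trans (σ-composeSplit-left v (I⇒V S u∈S)) (sym (+-identityʳ _))))
        (sym (cong₂ _+_ (mult-in S p) (mult-out T λ (u∈T , _) → disj (I⇒V S u∈S) (I⇒V T u∈T))))
      cases (no ¬p) (yes q@(u∈T , _)) _ = trans
        (trans (mult-in C (inC-right q)) (σ-composeSplit-right v (I⇒V T u∈T)))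
        (sym (cong₂ _+_ (mult-out S ¬p) (mult-in T q)))
      cases (no ¬p) (no ¬q) (yes r) = trans
        (trans (mult-in C r) (σ-composeSplit-cross r ¬p ¬q))
        (sym (cong₂ _+_ (mult-out S ¬p) (mult-out T ¬q)))
      cases (no ¬p) (no ¬q) (no ¬r) = trans (mult-out C ¬r)
        (sym (cong₂ _+_ (mult-out S ¬p) (mult-out T ¬q)))

Φ-composeAllSplit : ∀ {N} (S : SplitGraph N) (Ss : List (SplitGraph N))
  (disj : AllPairs Disjoint (map graph (S ∷ Ss))) →
  Φ (composeAllSplit S Ss disj) ≈ₘ ⨃ (map Φ (S ∷ Ss))
-- `⨃` folds down to the empty multigraph, so even a single factor comes with a union with `∅ₘ`.
Φ-composeAllSplit S []       _        = record
  { W-≡ = sym (∪-identityʳ (I S)) ; mult-≡ = λ u v → sym (+-identityʳ (mult (Φ S) u v)) }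
Φ-composeAllSplit S (T ∷ Ts) (d ∷ ds) = record
  { W-≡ = cong (I S ∪_) (_≈ₘ_.W-≡ rest)
  ; mult-≡ = λ u v → trans (_≈ₘ_.mult-≡ (Φ-composeSplit S (composeAllSplit T Ts ds) _) u v)
                           (cong (mult (Φ S) u v +_) (_≈ₘ_.mult-≡ rest u v))
  }
  where
  rest : Φ (composeAllSplit T Ts ds) ≈ₘ ⨃ (map Φ (T ∷ Ts))
  rest = Φ-composeAllSplit T Ts ds

-- Activity of the factors and assembly of the three claims.

Active-factors : ∀ {N} (Ss : List (SplitGraph N)) (G : Graph N)
  (disj : AllPairs Disjoint (factors Ss G)) →
  Active (composeAll Ss G disj) → All Active (factors Ss G)
Active-factors []       G _        active = active ∷ []
Active-factors (S ∷ Ss) G (d ∷ ds) active =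
  (λ {v} → Active-left S (composeAll Ss G ds) _ active {v})
  ∷ Active-factors Ss G ds (Active-right S (composeAll Ss G ds) _ active)

Prime⇔Connected : ∀ {N} (S : SplitGraph N) → Active (graph S) →
  Prime (graph S) ⇔ Connected (underlying (Φ S))
Prime⇔Connected S active = mk⇔ connected prime
  where
  connected : Prime (graph S) → Connected (underlying (Φ S))
  connected (_ , indec) = Indecomposable⇒Connected S indec

  prime : Connected (underlying (Φ S)) → Prime (graph S)
  prime conn = active , Connected⇒Indecomposable S active conn

theorem2p7 : (∀ {N : ℕ} (S : SplitGraph N) → Active (graph S) →
    Prime (graph S) ⇔ Connected (underlying (Φ S)))
    ×
    (∀ {N : ℕ} (S₁ : SplitGraph N) (Ss : List (SplitGraph N))
    (disj : AllPairs Disjoint (map graph (S₁ ∷ Ss))) →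
    All (λ S → Prime (graph S)) (S₁ ∷ Ss) →
    Φ (composeAllSplit S₁ Ss disj) ≈ₘ ⨃ (map Φ (S₁ ∷ Ss)))
    ×
    (∀ {N : ℕ} (G : Graph N) → Active G →
    (Ss : List (SplitGraph N)) (G₁ : Graph N)
    (disj : AllPairs Disjoint (factors Ss G₁)) →
    All (λ Gᵣ → Indecomposable Gᵣ × Nonempty (V Gᵣ)) (factors Ss G₁) →
    G ≈ composeAll Ss G₁ disj →
    All Prime (factors Ss G₁))
theorem2p7 =
  Prime⇔Connected
  , (λ S₁ Ss disj _ → Φ-composeAllSplit S₁ Ss disj)
  -- Indecomposability of the factors is given with the decomposition, so primality comes down to
  -- activity, carried from `G` to the composition and then to each factor.
  , (λ G active Ss G₁ disj indec G≈ →
      All.zipWith active∧indecomposable⇒prime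
        (Active-factors Ss G₁ disj (Active-resp G≈ active) , indec))
  where
  active∧indecomposable⇒prime : ∀ {N} {G : Graph N} →
    Active G × Indecomposable G × Nonempty (V G) → Prime G
  active∧indecomposable⇒prime (active , indec , _) = active , indec
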